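{- Let $k\ge 3$ and $r\ge 2(k-1)$ be integers such that there exists at least one $r$-regular graph on $3k-1$ vertices with chromatic number $k$. Then $d(3k-1,r,\chi=k)=k-1$.
   Context: All graphs are finite and simple. For a graph $G$, $\chi(G)$ denotes its chromatic number. A set $S$ of vertices of $G$ together with an assignment of colors to the vertices of $S$ is a defining set of the vertex coloring of $G$ if this partial coloring extends in exactly one way to a proper coloring of all vertices of $G$ with $\chi(G)$ colors. The defining number $d(G,\chi)$ is the minimum cardinality of a defining set of $G$. For integers $n,r,k$, $d(n,r,\chi=k)$ denotes the minimum of $d(G,\chi)$ over all $r$-regular graphs $G$ on $n$ vertices with $\chi(G)=k$. -}

module Defs where

open import Data.Nat using (ℕ; _≤_; _<_)
open import Data.Fin using (Fin)
open import Data.Bool using (Bool; true; false)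
open import Data.List using (length; filter)
open import Data.List.Base using (allFin)
open import Data.Fin.Subset using (Subset; _∈_; ∣_∣)
open import Data.Product using (Σ; ∃; _×_)
open import Relation.Binary.PropositionalEquality using (_≡_; _≢_)
open import Relation.Nullary using (¬_)
open import Relation.Nullary.Decidable using (does)
open import Data.Bool.Properties using (T?)
open import Data.Bool using (T)

record Graph (n : ℕ) : Set where
  field
    adj   : Fin n → Fin n → Bool
    sym   : ∀ u v → adj u v ≡ adj v u
    irref : ∀ v → adj v v ≡ false
open Graph public

degree : ∀ {n} → Graph n → Fin n → ℕ
degree G v = length (filter (λ u → T? (adj G v u)) (allFin _))

Regular : ∀ {n} → ℕ → Graph n → Set
Regular r G = ∀ v → degree G v ≡ r

Proper : ∀ {n k} → Graph n → (Fin n → Fin k) → Set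
Proper G c = ∀ u v → adj G u v ≡ true → c u ≢ c v

Colourable : ∀ {n} → Graph n → ℕ → Set
Colourable {n} G k = Σ (Fin n → Fin k) (Proper G)

ChromaticNumber : ∀ {n} → Graph n → ℕ → Set
ChromaticNumber G k = Colourable G k × (∀ m → m < k → ¬ Colourable G m)

Extends : ∀ {n k} → Subset n → (Fin n → Fin k) → (Fin n → Fin k) → Set
Extends S f c = ∀ v → v ∈ S → c v ≡ f v

IsDefiningSet : ∀ {n} → Graph n → (k : ℕ) → Subset n → (Fin n → Fin k) → Set
IsDefiningSet G k S f =
  Σ (Fin _ → Fin k) (λ c → Proper G c × Extends S f c ×
     (∀ c' → Proper G c' → Extends S f c' → ∀ v → c' v ≡ c v))

-- d(G, χ) = m, where χ(G) = k
DefiningNumber : ∀ {n} → Graph n → (k : ℕ) → ℕ → Set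
DefiningNumber {n} G k m =
  Σ (Subset n) (λ S → Σ (Fin n → Fin k) (λ f → ∣ S ∣ ≡ m × IsDefiningSet G k S f))
  × (∀ (S : Subset n) (f : Fin n → Fin k) → IsDefiningSet G k S f → m ≤ ∣ S ∣)

MinDefiningNumber : ℕ → ℕ → ℕ → ℕ → Set
MinDefiningNumber n r k m =
  Σ (Graph n) (λ G → Regular r G × ChromaticNumber G k × DefiningNumber G k m)
  × (∀ (G : Graph n) → Regular r G → ChromaticNumber G k →
       ∀ m' → DefiningNumber G k m' → m ≤ m')

{-# OPTIONS --safe #-}
module Submission where

-- Lower bound: if a defining set used fewer than k − 1 colours, two colours x, y would be absent from
-- it; exchanging x and y in the extension gives another extension, so by uniqueness x and y do not
-- occur at all, contradicting χ = k.
--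
-- Restrictions on r: put m = k − 1 and r = 2m + e. Each colour class has at most n − r vertices. If
-- n − r ≤ 3, the deficits 3 − |class| sum to 1, so exactly one class is smaller than 3; but a vertex
-- of it has a non-neighbour in another class, and that class is then smaller than 3 as well. Hence
-- e + 2 ≤ m. The handshake lemma gives that m or e is even.
--
-- Construction: vertices A₀ … A_m, B₀ … B_m, C₁ … C_m, coloured by index. The A's and the B's are
-- cliques, C_j is joined to all A_i and B_i with i ≠ j, and the C's carry an e-regular graph.
-- Between the A's and the B's lies a loopless bipartite graph of degree e + 1 everywhere except
-- degree e at A₀ and B₀. The C's form a defining set: A₀ and B₀ see the colours 1 … m on them, so
-- they receive colour 0, and then A_i and B_i can only receive colour i.

open import Defs
open import Data.Bool using (Bool; true; false; not; _∧_; _∨_; if_then_else_; T)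
open import Data.Bool.Properties using (T?; ∧-comm; ∧-zeroʳ)
open import Data.Fin using (Fin; zero; suc; toℕ; _↑ˡ_; _↑ʳ_; splitAt; join; punchIn; punchOut)
open import Data.Fin.Permutation.Components using (transpose; transpose-inverse)
open import Data.Fin.Properties using (_≟_; toℕ<n; any?; pigeonhole; punchInᵢ≢i; punchOut-injective; ¬∀⟶∃¬; splitAt-join; join-splitAt)
open import Data.Fin.Subset using (Subset; _∈_; ∣_∣)
open import Data.List using (List; []; _∷_; length; lookup; filter; tabulate)
open import Data.List.Membership.Propositional using () renaming (_∈_ to _∈ˡ_; _∉_ to _∉ˡ_)
import Data.List.Relation.Unary.Any as Any
open import Data.List.Relation.Unary.Any using (here; there; index)
open import Data.List.Relation.Unary.Any.Properties using (lookup-index)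
open import Data.Nat using (ℕ; zero; suc; _+_; _*_; _∸_; _≤_; _<_; z≤n; s≤s; s≤s⁻¹; _<?_; _≤?_; _<ᵇ_; _≤ᵇ_; _≡ᵇ_)
open import Data.Nat.Divisibility using (_∣_; _∣?_; divides; ∣m+n∣m⇒∣n; ∣m∣n⇒∣m+n)
open import Data.Nat.Primality using (euclidsLemma; prime?)
open import Data.Nat.Properties hiding (_≟_)
open import Data.Nat.Tactic.RingSolver using (solve-∀)
open import Data.Product using (Σ; ∃; _×_; _,_; proj₁; proj₂)
open import Data.Sum using (_⊎_; inj₁; inj₂; [_,_]′)
import Data.Sum as Sum
open import Data.Vec using ([]; _∷_)
import Data.Vec as Vec
open import Data.Vec.Properties using (lookup⇒[]=; lookup∘tabulate)
open import Function using (_∘_)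
open import Relation.Binary.Definitions using (tri<; tri≈; tri>)
open import Relation.Binary.PropositionalEquality renaming (sym to ≡-sym)
open import Relation.Nullary using (¬_; Dec; yes; no; does; contradiction)
open import Relation.Nullary.Decidable using (dec-true; dec-false; from-yes; from-no)

open import Algebra.Properties.CommutativeMonoid.Sum +-0-commutativeMonoid using (sum; sum-cong-≗; ∑-distrib-+; ∑-comm)

-- Finite sums

ind : Bool → ℕ
ind true  = 1
ind false = 0

ind-not : ∀ b → ind (not b) + ind b ≡ 1
ind-not true  = refl
ind-not false = refl

sum-const : ∀ n x → sum {n} (λ _ → x) ≡ n * x
sum-const zero    x = refl
sum-const (suc n) x = cong (x +_) (sum-const n x)

sum-zero : ∀ n → sum {n} (λ _ → 0) ≡ 0
sum-zero n = trans (sum-const n 0) (*-zeroʳ n)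

sum-one : ∀ n → sum {n} (λ _ → 1) ≡ n
sum-one n = trans (sum-const n 1) (*-identityʳ n)

sum-mono : ∀ {n} {f g : Fin n → ℕ} → (∀ i → f i ≤ g i) → sum f ≤ sum g
sum-mono {zero}  f≤g = z≤n
sum-mono {suc n} f≤g = +-mono-≤ (f≤g zero) (sum-mono (f≤g ∘ suc))

sum-mono-< : ∀ {n} {f g : Fin n → ℕ} → (∀ i → f i ≤ g i) → ∀ i → f i < g i → sum f < sum g
sum-mono-< f≤g zero    f<g = +-mono-<-≤ f<g (sum-mono (f≤g ∘ suc))
sum-mono-< f≤g (suc i) f<g = +-mono-≤-< (f≤g zero) (sum-mono-< (f≤g ∘ suc) i f<g)

-- Turns a count into a witness: a member of a nonempty class, a small class, a non-neighbour
-- outside a class.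
sum-<⇒∃< : ∀ {n} {f g : Fin n → ℕ} → sum f < sum g → ∃ λ i → f i < g i
sum-<⇒∃< {f = f} {g} f<g with any? (λ i → f i <? g i)
... | yes p = p
... | no ¬p = contradiction f<g (≤⇒≯ (sum-mono λ i → ≮⇒≥ (¬p ∘ (i ,_))))

≤-sum : ∀ {n} (f : Fin n → ℕ) i → f i ≤ sum f
≤-sum f zero    = m≤m+n _ _
≤-sum f (suc i) = m≤n⇒m≤o+n (f zero) (≤-sum (f ∘ suc) i)

+-≤-sum : ∀ {n} (f : Fin n → ℕ) {i j} → i ≢ j → f i + f j ≤ sum f
+-≤-sum f {zero}  {zero}  i≢j = contradiction refl i≢j
+-≤-sum f {zero}  {suc j} i≢j = +-monoʳ-≤ (f zero) (≤-sum (f ∘ suc) j)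
+-≤-sum f {suc i} {zero}  i≢j rewrite +-comm (f (suc i)) (f zero) = +-monoʳ-≤ (f zero) (≤-sum (f ∘ suc) i)
+-≤-sum f {suc i} {suc j} i≢j = m≤n⇒m≤o+n (f zero) (+-≤-sum (f ∘ suc) (i≢j ∘ cong suc))

sum-splitAt : ∀ a b (f : Fin (a + b) → ℕ) → sum f ≡ sum (f ∘ (_↑ˡ b)) + sum (f ∘ (a ↑ʳ_))
sum-splitAt zero    b f = refl
sum-splitAt (suc a) b f = trans (cong (f zero +_) (sum-splitAt a b (f ∘ suc))) (≡-sym (+-assoc (f zero) _ _))

sum-≟ : ∀ {n} (i : Fin n) → sum (λ j → ind (does (i ≟ j))) ≡ 1
sum-≟ {suc n} zero    = cong suc (sum-zero n)
sum-≟ {suc n} (suc i) = sum-≟ i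

sum-not : ∀ {n} (f : Fin n → Bool) → sum (ind ∘ not ∘ f) + sum (ind ∘ f) ≡ n
sum-not {n} f = trans (≡-sym (∑-distrib-+ (ind ∘ not ∘ f) (ind ∘ f)))
  (trans (sum-cong-≗ (ind-not ∘ f)) (sum-one n))

-- The degree inside a clique on `suc m` vertices, and the number of neighbours that a `C` vertex
-- has in each of the two cliques.
sum-≢ : ∀ {m} (i : Fin (suc m)) → sum (λ j → ind (not (does (i ≟ j)))) ≡ m
sum-≢ {m} i = suc-injective (trans (+-comm 1 _)
  (trans (cong (sum (λ j → ind (not (does (i ≟ j)))) +_) (≡-sym (sum-≟ i))) (sum-not (λ j → does (i ≟ j)))))

length-filter-tabulate : ∀ {n} {A : Set} (p : A → Bool) (g : Fin n → A) →
  length (filter (λ a → T? (p a)) (tabulate g)) ≡ sum (ind ∘ p ∘ g)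
length-filter-tabulate {zero}  p g = refl
length-filter-tabulate {suc n} p g with p (g zero)
... | true  = cong suc (length-filter-tabulate p (g ∘ suc))
... | false = length-filter-tabulate p (g ∘ suc)

degree-sum : ∀ {n} (G : Graph n) v → degree G v ≡ sum (λ u → ind (adj G v u))
degree-sum G v = length-filter-tabulate (adj G v) (λ u → u)

-- Sums over initial segments of the naturals, and cyclic offsets

sumℕ : ℕ → (ℕ → ℕ) → ℕ
sumℕ n f = sum {n} (f ∘ toℕ)

sumℕ-cong : ∀ n {f g : ℕ → ℕ} → (∀ i → i < n → f i ≡ g i) → sumℕ n f ≡ sumℕ n g
sumℕ-cong n f≡g = sum-cong-≗ λ i → f≡g (toℕ i) (toℕ<n i)

sumℕ-distrib-+ : ∀ n f g → sumℕ n (λ i → f i + g i) ≡ sumℕ n f + sumℕ n g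
sumℕ-distrib-+ n f g = ∑-distrib-+ {n} (f ∘ toℕ) (g ∘ toℕ)

sumℕ-+ : ∀ a b f → sumℕ (a + b) f ≡ sumℕ a f + sumℕ b (f ∘ (a +_))
sumℕ-+ zero    b f = refl
sumℕ-+ (suc a) b f = trans (cong (f 0 +_) (sumℕ-+ a b (f ∘ suc))) (≡-sym (+-assoc (f 0) _ _))

sumℕ-last : ∀ n f → sumℕ (suc n) f ≡ f n + sumℕ n f
sumℕ-last n f = begin
  sumℕ (suc n) f                    ≡⟨ cong (λ x → sumℕ x f) (+-comm 1 n) ⟩
  sumℕ (n + 1) f                    ≡⟨ sumℕ-+ n 1 f ⟩
  sumℕ n f + (f (n + 0) + 0)        ≡⟨ +-comm (sumℕ n f) _ ⟩
  f (n + 0) + 0 + sumℕ n f          ≡⟨ cong (_+ sumℕ n f) (trans (+-identityʳ _) (cong f (+-identityʳ n))) ⟩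
  f n + sumℕ n f                    ∎
  where open ≡-Reasoning

sumℕ-reverse : ∀ n f → sumℕ n (λ i → f (n ∸ suc i)) ≡ sumℕ n f
sumℕ-reverse zero    f = refl
sumℕ-reverse (suc n) f = trans (cong (f n +_) (sumℕ-reverse n f)) (≡-sym (sumℕ-last n f))

sumℕ-< : ∀ {q n} → q ≤ n → sumℕ n (λ i → ind (i <ᵇ q)) ≡ q
sumℕ-< {zero}  {n}     q≤n = sum-zero n
sumℕ-< {suc q} {suc n} q≤n = cong suc (sumℕ-< (s≤s⁻¹ q≤n))

sumℕ-≡ : ∀ {c n} → c < n → sumℕ n (λ i → ind (i ≡ᵇ c)) ≡ 1
sumℕ-≡ {zero}  {suc n} c<n = cong suc (sum-zero n)
sumℕ-≡ {suc c} {suc n} c<n = sumℕ-≡ (s≤s⁻¹ c<n)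

-- For i, j < n this is the residue of j − i modulo n.
off : ℕ → ℕ → ℕ → ℕ
off n i j = if does (i ≤? j) then j ∸ i else (n + j) ∸ i

off-≤ : ∀ n {i j} → i ≤ j → off n i j ≡ j ∸ i
off-≤ n {i} {j} i≤j rewrite dec-true (i ≤? j) i≤j = refl

off-> : ∀ n {i j} → j < i → off n i j ≡ (n + j) ∸ i
off-> n {i} {j} j<i rewrite dec-false (i ≤? j) (<⇒≱ j<i) = refl

-- Put n = i + l. The offsets are l, ..., l + i - 1 for j < i and 0, ..., l - 1 for j ≥ i, so each
-- residue occurs once.
sum-off-row : ∀ n i → i ≤ n → (P : ℕ → ℕ) → sumℕ n (λ j → P (off n i j)) ≡ sumℕ n P
sum-off-row n i i≤n P with m≤n⇒∃[o]m+o≡n i≤n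
... | l , refl = begin
  sumℕ (i + l) (λ j → P (off (i + l) i j))
    ≡⟨ sumℕ-+ i l (λ j → P (off (i + l) i j)) ⟩
  sumℕ i (λ j → P (off (i + l) i j)) + sumℕ l (λ j → P (off (i + l) i (i + j)))
    ≡⟨ cong₂ _+_
         (sumℕ-cong i λ j j<i → cong P (trans (off-> (i + l) j<i)
           (trans (cong (_∸ i) (+-assoc i l j)) (m+n∸m≡n i (l + j)))))
         (sumℕ-cong l λ j _ → cong P (trans (off-≤ (i + l) (m≤m+n i j)) (m+n∸m≡n i j))) ⟩
  sumℕ i (λ j → P (l + j)) + sumℕ l P
    ≡⟨ +-comm _ (sumℕ l P) ⟩
  sumℕ l P + sumℕ i (λ j → P (l + j))
    ≡⟨ sumℕ-+ l i P ⟨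
  sumℕ (l + i) P
    ≡⟨ cong (λ x → sumℕ x P) (+-comm l i) ⟩
  sumℕ (i + l) P ∎
  where open ≡-Reasoning

-- The reflection x ↦ m - x reverses differences; it reduces column sums of a matrix that depends
-- only on the offset to row sums.
off-reflect : ∀ m {i j} → i ≤ m → j ≤ m → off (suc m) i j ≡ off (suc m) (m ∸ j) (m ∸ i)
off-reflect m {i} {j} i≤m j≤m with i ≤? j
... | yes i≤j = trans (off-≤ (suc m) i≤j) (≡-sym (trans (off-≤ (suc m) (∸-monoʳ-≤ m i≤j)) (∸-reflect i≤m j≤m)))
  where
  ∸-reflect : ∀ {m i j} → i ≤ m → j ≤ m → (m ∸ i) ∸ (m ∸ j) ≡ j ∸ i
  ∸-reflect {m} {i} {j} i≤m j≤m = begin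
    (m ∸ i) ∸ (m ∸ j)  ≡⟨ ∸-+-assoc m i (m ∸ j) ⟩
    m ∸ (i + (m ∸ j))  ≡⟨ cong (m ∸_) (+-comm i (m ∸ j)) ⟩
    m ∸ ((m ∸ j) + i)  ≡⟨ ∸-+-assoc m (m ∸ j) i ⟨
    (m ∸ (m ∸ j)) ∸ i  ≡⟨ cong (_∸ i) (m∸[m∸n]≡n j≤m) ⟩
    j ∸ i              ∎
    where open ≡-Reasoning
... | no i≰j = trans (off-> (suc m) (≰⇒> i≰j)) (≡-sym (trans (off-> (suc m) (∸-monoʳ-< (≰⇒> i≰j) i≤m)) (begin
    (suc m + (m ∸ i)) ∸ (m ∸ j)  ≡⟨ cong (_∸ (m ∸ j)) (+-∸-assoc (suc m) i≤m) ⟨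
    ((suc m + m) ∸ i) ∸ (m ∸ j)  ≡⟨ ∸-+-assoc (suc m + m) i (m ∸ j) ⟩
    (suc m + m) ∸ (i + (m ∸ j))  ≡⟨ cong ((suc m + m) ∸_) (+-comm i (m ∸ j)) ⟩
    (suc m + m) ∸ ((m ∸ j) + i)  ≡⟨ ∸-+-assoc (suc m + m) (m ∸ j) i ⟨
    ((suc m + m) ∸ (m ∸ j)) ∸ i  ≡⟨ cong (_∸ i) (+-∸-assoc (suc m) (m∸n≤m m j)) ⟩
    (suc m + (m ∸ (m ∸ j))) ∸ i  ≡⟨ cong (λ x → (suc m + x) ∸ i) (m∸[m∸n]≡n j≤m) ⟩
    (suc m + j) ∸ i              ∎)))
  where open ≡-Reasoning

sum-off-col : ∀ m j → j ≤ m → (P : ℕ → ℕ) →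
  sumℕ (suc m) (λ i → P (off (suc m) i j)) ≡ sumℕ (suc m) P
sum-off-col m j j≤m P = begin
  sumℕ (suc m) (λ i → P (off (suc m) i j))
    ≡⟨ sumℕ-cong (suc m) (λ i i<n → cong P (off-reflect m (s≤s⁻¹ i<n) j≤m)) ⟩
  sumℕ (suc m) (λ i → P (off (suc m) (m ∸ j) (m ∸ i)))
    ≡⟨ sumℕ-reverse (suc m) (λ i → P (off (suc m) (m ∸ j) i)) ⟩
  sumℕ (suc m) (λ i → P (off (suc m) (m ∸ j) i))
    ≡⟨ sum-off-row (suc m) (m ∸ j) (m≤n⇒m≤1+n (m∸n≤m m j)) P ⟩
  sumℕ (suc m) P ∎
  where open ≡-Reasoning

-- Regular circulant graphs

-- The Cayley graph of ℤ/m with connection set `P`; the last hypothesis is closure under negation.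
circulant : (m : ℕ) (P : ℕ → Bool) → P 0 ≡ false →
  (∀ x → 0 < x → x < m → P x ≡ P (m ∸ x)) → Graph m
circulant m P P0 P-sym = record
  { adj   = λ i j → P (off m (toℕ i) (toℕ j))
  ; sym   = symmetric
  ; irref = λ i → trans (cong P (trans (off-≤ m (≤-refl {toℕ i})) (n∸n≡0 (toℕ i)))) P0
  }
  where
  increasing : ∀ {i j} → i < j → j < m → P (off m i j) ≡ P (off m j i)
  increasing {i} {j} i<j j<m = begin
    P (off m i j)     ≡⟨ cong P (off-≤ m (<⇒≤ i<j)) ⟩
    P (j ∸ i)         ≡⟨ P-sym (j ∸ i) (m<n⇒0<n∸m i<j) (≤-<-trans (m∸n≤m j i) j<m) ⟩
    P (m ∸ (j ∸ i))   ≡⟨ cong P (m∸[n∸o]≡m+o∸n m i (<⇒≤ i<j)) ⟩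
    P ((m + i) ∸ j)   ≡⟨ cong P (off-> m i<j) ⟨
    P (off m j i)     ∎
    where
    open ≡-Reasoning
    m∸[n∸o]≡m+o∸n : ∀ m {n} o → o ≤ n → m ∸ (n ∸ o) ≡ (m + o) ∸ n
    m∸[n∸o]≡m+o∸n m {n} o o≤n = begin
      m ∸ (n ∸ o)              ≡⟨ [m+n]∸[m+o]≡n∸o o m (n ∸ o) ⟨
      (o + m) ∸ (o + (n ∸ o))  ≡⟨ cong₂ _∸_ (+-comm o m) (m+[n∸m]≡n o≤n) ⟩
      (m + o) ∸ n              ∎
  symmetric : ∀ i j → P (off m (toℕ i) (toℕ j)) ≡ P (off m (toℕ j) (toℕ i))
  symmetric i j with <-cmp (toℕ i) (toℕ j)
  ... | tri< i<j _ _ = increasing i<j (toℕ<n j)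
  ... | tri≈ _ i≡j _ rewrite i≡j = refl
  ... | tri> _ _ j<i = ≡-sym (increasing j<i (toℕ<n i))

circulant-regular : ∀ m P P0 P-sym → Regular (sumℕ m (ind ∘ P)) (circulant m P P0 P-sym)
circulant-regular m P P0 P-sym v = trans (degree-sum (circulant m P P0 P-sym) v)
  (sum-off-row m (toℕ v) (<⇒≤ (toℕ<n v)) (ind ∘ P))

-- For positive p this is the interval from p to m - p; the tests are written so that x ↦ m - x
-- exchanges them.
central : ℕ → ℕ → ℕ → Bool
central m p x = (p ≤ᵇ x) ∧ (p ≤ᵇ m ∸ x)

central-sym : ∀ m p x → 0 < x → x < m → central m p x ≡ central m p (m ∸ x)
central-sym m p x _ x<m =
  trans (∧-comm (p ≤ᵇ x) _) (cong ((p ≤ᵇ m ∸ x) ∧_) (cong (p ≤ᵇ_) (≡-sym (m∸[m∸n]≡n (<⇒≤ x<m)))))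

-- With threshold p + 1 the offsets split into blocks of length p + 1, e and p: the first block
-- fails the lower test, the last one the upper test.
sum-central : ∀ e p → sumℕ (suc p + (e + p)) (ind ∘ central (suc p + (e + p)) (suc p)) ≡ e
sum-central e p = begin
  sumℕ (suc p + (e + p)) f
    ≡⟨ sumℕ-+ (suc p) (e + p) f ⟩
  sumℕ (suc p) f + sumℕ (e + p) (f ∘ (suc p +_))
    ≡⟨ cong (sumℕ (suc p) f +_) (sumℕ-+ e p (f ∘ (suc p +_))) ⟩
  sumℕ (suc p) f + (sumℕ e (f ∘ (suc p +_)) + sumℕ p (f ∘ (suc p +_) ∘ (e +_)))
    ≡⟨ cong₂ _+_ (sumℕ-cong (suc p) low) (cong₂ _+_ (sumℕ-cong e middle) (sumℕ-cong p high)) ⟩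
  sumℕ (suc p) (λ _ → 0) + (sumℕ e (λ _ → 1) + sumℕ p (λ _ → 0))
    ≡⟨ cong₂ _+_ (sum-zero (suc p))
         (cong₂ _+_ (sum-one e) (sum-zero p)) ⟩
  0 + (e + 0)
    ≡⟨ +-identityʳ e ⟩
  e ∎
  where
  open ≡-Reasoning
  m = suc p + (e + p)
  f = ind ∘ central m (suc p)
  low : ∀ x → x < suc p → f x ≡ 0
  low x x<p rewrite dec-false (suc p ≤? x) (<⇒≱ x<p) = refl
  middle : ∀ x → x < e → f (suc p + x) ≡ 1
  middle x x<e
    rewrite dec-true (suc p ≤? suc p + x) (m≤m+n (suc p) x)
          | [m+n]∸[m+o]≡n∸o p (e + p) x
          | dec-true (suc p ≤? e + p ∸ x) (m+n≤o⇒m≤o∸n (suc p) (≤-trans (≤-reflexive (+-comm (suc p) x))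
              (≤-trans (≤-reflexive (+-suc x p)) (+-monoˡ-≤ p x<e)))) = refl
  high : ∀ x → x < p → f (suc p + (e + x)) ≡ 0
  high x x<p
    rewrite [m+n]∸[m+o]≡n∸o p (e + p) (e + x)
          | [m+n]∸[m+o]≡n∸o e p x
          | dec-false (suc p ≤? p ∸ x) (<⇒≱ (s≤s (m∸n≤m p x)))
          | Data.Bool.Properties.∧-zeroʳ (suc p ≤ᵇ suc p + (e + x)) = refl

cocentral : ℕ → ℕ → ℕ → Bool
cocentral m p x = (1 ≤ᵇ x) ∧ not (central m p x)

cocentral-sym : ∀ m p x → 0 < x → x < m → cocentral m p x ≡ cocentral m p (m ∸ x)
cocentral-sym m p x 0<x x<m
  rewrite dec-true (1 ≤? x) 0<x | dec-true (1 ≤? m ∸ x) (m<n⇒0<n∸m x<m) = cong not (central-sym m p x 0<x x<m)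

-- The offset 0, the e central offsets and the cocentral ones partition all 2p + 1 + e offsets.
sum-cocentral : ∀ e p → sumℕ (suc p + (e + p)) (ind ∘ cocentral (suc p + (e + p)) (suc p)) ≡ p + p
sum-cocentral e p = +-cancelʳ-≡ (suc e) _ (p + p) (begin
  sumℕ m (ind ∘ cocentral m (suc p)) + (1 + e)
    ≡⟨ cong (sumℕ m (ind ∘ cocentral m (suc p)) +_) (cong₂ _+_ (sumℕ-≡ {0} {m} (s≤s z≤n)) (sum-central e p)) ⟨
  sumℕ m (ind ∘ cocentral m (suc p)) + (sumℕ m (λ x → ind (x ≡ᵇ 0)) + sumℕ m (ind ∘ central m (suc p)))
    ≡⟨ cong (sumℕ m (ind ∘ cocentral m (suc p)) +_) (sumℕ-distrib-+ m (λ x → ind (x ≡ᵇ 0)) (ind ∘ central m (suc p))) ⟨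
  sumℕ m (ind ∘ cocentral m (suc p)) + sumℕ m (λ x → ind (x ≡ᵇ 0) + ind (central m (suc p) x))
    ≡⟨ sumℕ-distrib-+ m (ind ∘ cocentral m (suc p)) (λ x → ind (x ≡ᵇ 0) + ind (central m (suc p) x)) ⟨
  sumℕ m (λ x → ind (cocentral m (suc p) x) + (ind (x ≡ᵇ 0) + ind (central m (suc p) x)))
    ≡⟨ sumℕ-cong m (λ x _ → partition x) ⟩
  sumℕ m (λ _ → 1)
    ≡⟨ sum-one m ⟩
  suc p + (e + p)
    ≡⟨ arith e p ⟩
  (p + p) + suc e ∎)
  where
  open ≡-Reasoning
  m = suc p + (e + p)
  partition : ∀ x → ind (cocentral m (suc p) x) + (ind (x ≡ᵇ 0) + ind (central m (suc p) x)) ≡ 1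
  partition zero    = refl
  partition (suc x) = ind-not (central m (suc p) (suc x))
  arith : ∀ e p → suc p + (e + p) ≡ (p + p) + suc e
  arith = solve-∀

-- Parity, and regular graphs of given degree

even-or-odd : ∀ n → ∃ λ p → n ≡ p + p ⊎ n ≡ suc (p + p)
even-or-odd zero = 0 , inj₁ refl
even-or-odd (suc n) with even-or-odd n
... | p , inj₁ refl = p , inj₂ refl
... | p , inj₂ refl = suc p , inj₁ (cong suc (≡-sym (+-suc p p)))

2∣p+p : ∀ p → 2 ∣ p + p
2∣p+p p = divides p (trans (cong (p +_) (≡-sym (+-identityʳ p))) (*-comm 2 p))

2∤1+p+p : ∀ p → ¬ 2 ∣ suc (p + p)
2∤1+p+p p d = contradiction (∣m+n∣m⇒∣n (subst (2 ∣_) (+-comm 1 (p + p)) d) (2∣p+p p)) (from-no (2 ∣? 1))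

central-regular : ∀ e p → Σ (Graph (suc p + (e + p))) (Regular e)
central-regular e p = G , subst (λ d → Regular d G) (sum-central e p) (circulant-regular m _ refl P-sym)
  where
  m = suc p + (e + p)
  P-sym = central-sym m (suc p)
  G = circulant m (central m (suc p)) refl P-sym

cocentral-regular : ∀ e p → Σ (Graph (suc p + (e + p))) (Regular (p + p))
cocentral-regular e p = G , subst (λ d → Regular d G) (sum-cocentral e p) (circulant-regular m _ refl P-sym)
  where
  m = suc p + (e + p)
  P-sym = cocentral-sym m (suc p)
  G = circulant m (cocentral m (suc p)) refl P-sym

-- The offsets from p to m − p give degree e when m − e is odd; otherwise m and e are both even and the
-- remaining nonzero offsets do.
regular-graph : ∀ m e → e < m → (2 ∣ m) ⊎ (2 ∣ e) → Σ (Graph m) (Regular e)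
regular-graph m e e<m 2∣m⊎2∣e with m≤n⇒∃[o]m+o≡n e<m
... | g , refl with even-or-odd g
...   | p , inj₁ refl = subst (λ n → Σ (Graph n) (Regular e)) (arith e p) (central-regular e p)
  where
  arith : ∀ e p → suc p + (e + p) ≡ suc e + (p + p)
  arith = solve-∀
...   | p , inj₂ refl with even-or-odd e
-- Here m = 2h + (2p + 1) + 1: a central block of 2p + 1 offsets is left out, and h nonzero offsets
-- remain on each side of it.
...     | h , inj₁ refl = subst (λ n → Σ (Graph n) (Regular e)) (arith h p) (cocentral-regular (suc (p + p)) h)
  where
  arith : ∀ h p → suc h + (suc (p + p) + h) ≡ suc (h + h) + suc (p + p)
  arith = solve-∀
-- With e and m - e - 1 both odd, m is odd as well, against the parity hypothesis.
...     | h , inj₂ refl = contradiction 2∣m⊎2∣e [ 2∤1+p+p (suc (h + p)) ∘ subst (2 ∣_) (arith h p) , 2∤1+p+p h ]′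
  where
  arith : ∀ h p → suc (suc (h + h)) + suc (p + p) ≡ suc (suc (h + p) + suc (h + p))
  arith = solve-∀

-- The bipartite graph between the two cliques

sumℕ-∧-≡ : ∀ {c n} b → c < n → sumℕ n (λ j → ind (b ∧ (j ≡ᵇ c))) ≡ ind b
sumℕ-∧-≡         true  c<n = sumℕ-≡ c<n
sumℕ-∧-≡ {n = n} false c<n = sum-zero n

sumℕ-≡-∧ : ∀ {c n} b → c < n → sumℕ n (λ i → ind ((i ≡ᵇ c) ∧ b)) ≡ ind b
sumℕ-≡-∧ {c} {n} b c<n = trans (sumℕ-cong n λ i _ → cong ind (∧-comm (i ≡ᵇ c) b)) (sumℕ-∧-≡ b c<n)

≡ᵇ-true : ∀ m n → (m ≡ᵇ n) ≡ true → m ≡ n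
≡ᵇ-true m n eq = ≡ᵇ⇒≡ m n (subst T (≡-sym eq) _)

-- p, q, s, t stand for i = 0, j = e + 1, i = m, j = 0: the entries (0, e + 1) and (m, 0)
-- of a matrix are cleared and (m, e + 1) is set, which moves one unit out of row 0 and column 0
-- and leaves every other row and column sum unchanged.
switch : (p q s t x : Bool) → Bool
switch p q s t x = if (p ∧ q) ∨ (s ∧ t) then false else if s ∧ q then true else x

-- Additive, so that no truncated subtraction arises. The first two hypotheses say that i = 0
-- excludes i = m and j = 0 excludes j = e + 1; the others say that the cleared entries held 1 and
-- the entry to be set held 0.
ind-switch : ∀ p q s t x →
  (p ≡ true → s ≢ true) → (t ≡ true → q ≢ true) →
  (p ≡ true → q ≡ true → x ≡ true) → (s ≡ true → t ≡ true → x ≡ true) →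
  (s ≡ true → q ≡ true → x ≡ false) →
  ind (switch p q s t x) + (ind (p ∧ q) + ind (s ∧ t)) ≡ ind x + ind (s ∧ q)
ind-switch true  _     true  _     x ¬ps ¬tq pq st sq = contradiction refl (¬ps refl)
ind-switch _     true  _     true  x ¬ps ¬tq pq st sq = contradiction refl (¬tq refl)
ind-switch true  true  false false x ¬ps ¬tq pq st sq rewrite pq refl refl = refl
ind-switch true  false false t     x ¬ps ¬tq pq st sq = refl
ind-switch false q     false t     x ¬ps ¬tq pq st sq = refl
ind-switch false false true  true  x ¬ps ¬tq pq st sq rewrite st refl refl = refl
ind-switch false false true  false x ¬ps ¬tq pq st sq = refl
ind-switch false true  true  false x ¬ps ¬tq pq st sq rewrite sq refl refl = refl

module Link (m e : ℕ) (1+e<m : suc e < m) where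

  -- The offsets 1, ..., e + 1. Leaving out 0 keeps `A i` and `B i`, which share a colour,
  -- nonadjacent.
  step : ℕ → Bool
  step zero    = false
  step (suc x) = x <ᵇ suc e

  sum-step : sumℕ (suc m) (ind ∘ step) ≡ suc e
  sum-step = sumℕ-< {suc e} {m} (<⇒≤ 1+e<m)

  link : ℕ → ℕ → Bool
  link i j = switch (i ≡ᵇ 0) (j ≡ᵇ suc e) (i ≡ᵇ m) (j ≡ᵇ 0) (step (off (suc m) i j))

  link-entry : ∀ i j →
    ind (link i j) + (ind ((i ≡ᵇ 0) ∧ (j ≡ᵇ suc e)) + ind ((i ≡ᵇ m) ∧ (j ≡ᵇ 0)))
      ≡ ind (step (off (suc m) i j)) + ind ((i ≡ᵇ m) ∧ (j ≡ᵇ suc e))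
  link-entry i j = ind-switch (i ≡ᵇ 0) (j ≡ᵇ suc e) (i ≡ᵇ m) (j ≡ᵇ 0) _
    (λ i≡0 i≡m → contradiction (trans (≡-sym (≡ᵇ-true i 0 i≡0)) (≡ᵇ-true i m i≡m)) (<⇒≢ 0<m))
    (λ j≡0 j≡1+e → contradiction (trans (≡-sym (≡ᵇ-true j 0 j≡0)) (≡ᵇ-true j (suc e) j≡1+e)) λ ())
    -- The offsets at (0, e + 1), (m, 0) and (m, e + 1) are e + 1, 1 and e + 2: the first two are
    -- steps, the third is one too large.
    (λ i≡0 j≡1+e → first (≡ᵇ-true i 0 i≡0) (≡ᵇ-true j (suc e) j≡1+e))
    (λ i≡m j≡0 → second (≡ᵇ-true i m i≡m) (≡ᵇ-true j 0 j≡0))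
    (λ i≡m j≡1+e → third (≡ᵇ-true i m i≡m) (≡ᵇ-true j (suc e) j≡1+e))
    where
    0<m : 0 < m
    0<m = <-trans (s≤s z≤n) 1+e<m
    first : ∀ {i j} → i ≡ 0 → j ≡ suc e → step (off (suc m) i j) ≡ true
    first refl refl = dec-true (e <? suc e) ≤-refl
    second : ∀ {i j} → i ≡ m → j ≡ 0 → step (off (suc m) i j) ≡ true
    second refl refl = cong step (trans (off-> (suc m) 0<m)
      (trans (cong (λ x → suc x ∸ m) (+-identityʳ m)) (m+n∸n≡m 1 m)))
    third : ∀ {i j} → i ≡ m → j ≡ suc e → step (off (suc m) i j) ≡ false
    third refl refl = trans
      (cong step (trans (off-> (suc m) 1+e<m) (trans (cong (_∸ m) (≡-sym (+-suc m (suc e)))) (m+n∸m≡n m (suc (suc e))))))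
      (dec-false (suc e <? suc e) (<-irrefl refl))

  -- Sum `link-entry` along the row. In row m the cleared entry and the set entry balance, which is
  -- why `ind (i ≡ᵇ m)` is added to both sides and cancelled.
  link-row : ∀ i → i ≤ m → sumℕ (suc m) (ind ∘ link i) + ind (i ≡ᵇ 0) ≡ suc e
  link-row i i≤m = +-cancelʳ-≡ (ind (i ≡ᵇ m)) _ _ (begin
    R + ind (i ≡ᵇ 0) + ind (i ≡ᵇ m)
      ≡⟨ +-assoc R _ _ ⟩
    R + (ind (i ≡ᵇ 0) + ind (i ≡ᵇ m))
      ≡⟨ cong (R +_) (cong₂ _+_ (sumℕ-∧-≡ (i ≡ᵇ 0) (m<n⇒m<1+n 1+e<m)) (sumℕ-∧-≡ {0} {suc m} (i ≡ᵇ m) (s≤s z≤n))) ⟨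
    R + (sumℕ (suc m) f + sumℕ (suc m) g)
      ≡⟨ cong (R +_) (sumℕ-distrib-+ (suc m) f g) ⟨
    R + sumℕ (suc m) (λ j → f j + g j)
      ≡⟨ sumℕ-distrib-+ (suc m) (ind ∘ link i) (λ j → f j + g j) ⟨
    sumℕ (suc m) (λ j → ind (link i j) + (f j + g j))
      ≡⟨ sumℕ-cong (suc m) (λ j _ → link-entry i j) ⟩
    sumℕ (suc m) (λ j → ind (step (off (suc m) i j)) + ind ((i ≡ᵇ m) ∧ (j ≡ᵇ suc e)))
      ≡⟨ sumℕ-distrib-+ (suc m) (λ j → ind (step (off (suc m) i j))) (λ j → ind ((i ≡ᵇ m) ∧ (j ≡ᵇ suc e))) ⟩
    sumℕ (suc m) (λ j → ind (step (off (suc m) i j))) + sumℕ (suc m) (λ j → ind ((i ≡ᵇ m) ∧ (j ≡ᵇ suc e)))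
      ≡⟨ cong₂ _+_ (trans (sum-off-row (suc m) i (m≤n⇒m≤1+n i≤m) (ind ∘ step)) sum-step)
                   (sumℕ-∧-≡ (i ≡ᵇ m) (m<n⇒m<1+n 1+e<m)) ⟩
    suc e + ind (i ≡ᵇ m) ∎)
    where
    open ≡-Reasoning
    R = sumℕ (suc m) (ind ∘ link i)
    f g : ℕ → ℕ
    f j = ind ((i ≡ᵇ 0) ∧ (j ≡ᵇ suc e))
    g j = ind ((i ≡ᵇ m) ∧ (j ≡ᵇ 0))

  -- Here the balance is in column e + 1, which loses (0, e + 1) and gains (m, e + 1).
  link-col : ∀ j → j ≤ m → sumℕ (suc m) (λ i → ind (link i j)) + ind (j ≡ᵇ 0) ≡ suc e
  link-col j j≤m = +-cancelʳ-≡ (ind (j ≡ᵇ suc e)) _ _ (begin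
    C + ind (j ≡ᵇ 0) + ind (j ≡ᵇ suc e)
      ≡⟨ trans (+-assoc C _ _) (cong (C +_) (+-comm (ind (j ≡ᵇ 0)) _)) ⟩
    C + (ind (j ≡ᵇ suc e) + ind (j ≡ᵇ 0))
      ≡⟨ cong (C +_) (cong₂ _+_ (sumℕ-≡-∧ {0} {suc m} (j ≡ᵇ suc e) (s≤s z≤n)) (sumℕ-≡-∧ (j ≡ᵇ 0) (n<1+n m))) ⟨
    C + (sumℕ (suc m) f + sumℕ (suc m) g)
      ≡⟨ cong (C +_) (sumℕ-distrib-+ (suc m) f g) ⟨
    C + sumℕ (suc m) (λ i → f i + g i)
      ≡⟨ sumℕ-distrib-+ (suc m) (λ i → ind (link i j)) (λ i → f i + g i) ⟨
    sumℕ (suc m) (λ i → ind (link i j) + (f i + g i))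
      ≡⟨ sumℕ-cong (suc m) (λ i _ → link-entry i j) ⟩
    sumℕ (suc m) (λ i → ind (step (off (suc m) i j)) + ind ((i ≡ᵇ m) ∧ (j ≡ᵇ suc e)))
      ≡⟨ sumℕ-distrib-+ (suc m) (λ i → ind (step (off (suc m) i j))) (λ i → ind ((i ≡ᵇ m) ∧ (j ≡ᵇ suc e))) ⟩
    sumℕ (suc m) (λ i → ind (step (off (suc m) i j))) + sumℕ (suc m) (λ i → ind ((i ≡ᵇ m) ∧ (j ≡ᵇ suc e)))
      ≡⟨ cong₂ _+_ (trans (sum-off-col m j j≤m (ind ∘ step)) sum-step) (sumℕ-≡-∧ (j ≡ᵇ suc e) (n<1+n m)) ⟩
    suc e + ind (j ≡ᵇ suc e) ∎)
    where
    open ≡-Reasoning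
    C = sumℕ (suc m) (λ i → ind (link i j))
    f g : ℕ → ℕ
    f i = ind ((i ≡ᵇ 0) ∧ (j ≡ᵇ suc e))
    g i = ind ((i ≡ᵇ m) ∧ (j ≡ᵇ 0))

  -- Offset 0 is not a step, and the one entry that is set, (m, e + 1), is off the diagonal because
  -- e + 1 < m.
  link-irrefl : ∀ i → link i i ≡ false
  link-irrefl i = go (i ≡ᵇ 0) (i ≡ᵇ suc e) (i ≡ᵇ m)
    (λ i≡m i≡1+e → <⇒≢ 1+e<m (trans (≡-sym (≡ᵇ-true i (suc e) i≡1+e)) (≡ᵇ-true i m i≡m)))
    (cong step (trans (off-≤ (suc m) (≤-refl {i})) (n∸n≡0 i)))
    where
    go : ∀ p q s {t x} → (s ≡ true → q ≢ true) → x ≡ false → switch p q s t x ≡ false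
    go true  true  s     ¬sq x≡f = refl
    go false true  true  ¬sq x≡f = contradiction refl (¬sq refl)
    go false true  false ¬sq x≡f = x≡f
    go p     false false ¬sq x≡f = trans (cong (λ b → if b ∨ false then false else _) (∧-zeroʳ p)) x≡f
    go p     false true {t} ¬sq x≡f rewrite ∧-zeroʳ p with t
    ... | true  = refl
    ... | false = x≡f

-- Size of defining sets

-- Otherwise every colour has a position in `L`; pigeonhole gives two colours the same position, and
-- looking it up makes them equal.
missing : ∀ {k} (L : List (Fin k)) → length L < k → ∃ λ x → x ∉ˡ L
missing {k} L |L|<k = ¬∀⟶∃¬ k (_∈ˡ L) (λ x → Any.any? (x ≟_) L) λ all∈ →
  let x , y , x<y , eq = pigeonhole |L|<k (index ∘ all∈)
  in <⇒≢ x<y (cong toℕ (trans (lookup-index (all∈ x)) (trans (cong (lookup L) eq) (≡-sym (lookup-index (all∈ y))))))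

image : ∀ {n} {A : Set} → Subset n → (Fin n → A) → List A
image []          f = []
image (true  ∷ S) f = f zero ∷ image S (f ∘ suc)
image (false ∷ S) f = image S (f ∘ suc)

length-image : ∀ {n} {A : Set} (S : Subset n) (f : Fin n → A) → length (image S f) ≡ ∣ S ∣
length-image []          f = refl
length-image (true  ∷ S) f = cong suc (length-image S (f ∘ suc))
length-image (false ∷ S) f = length-image S (f ∘ suc)

∈-image : ∀ {n} {A : Set} (S : Subset n) (f : Fin n → A) {v} → v ∈ S → f v ∈ˡ image S f
∈-image (true  ∷ S) f Vec.here      = here refl
∈-image (true  ∷ S) f (Vec.there p) = there (∈-image S (f ∘ suc) p)
∈-image (false ∷ S) f (Vec.there p) = ∈-image S (f ∘ suc) p

transpose-fst : ∀ {n} (i j : Fin n) → transpose i j i ≡ j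
transpose-fst i j rewrite dec-true (i ≟ i) refl = refl

transpose-other : ∀ {n} (i j : Fin n) {k} → k ≢ i → k ≢ j → transpose i j k ≡ k
transpose-other i j {k} k≢i k≢j rewrite dec-false (k ≟ i) k≢i | dec-false (k ≟ j) k≢j = refl

∣definingSet∣≥χ-1 : ∀ {n m} (G : Graph n) → ChromaticNumber G (suc m) →
  ∀ S f → IsDefiningSet G (suc m) S f → m ≤ ∣ S ∣
∣definingSet∣≥χ-1 {m = m} G (_ , χ-min) S f (c , c-proper , c-ext , c-unique) with m ≤? ∣ S ∣
... | yes m≤|S| = m≤|S|
... | no  m≰|S| = contradiction ((λ v → punchOut (x-unused v)) , λ u v uv eq →
        c-proper u v uv (punchOut-injective (x-unused u) (x-unused v) eq)) (χ-min m ≤-refl)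
  where
  |S|<m : ∣ S ∣ < m
  |S|<m = ≰⇒> m≰|S|
  x∉ = missing (image S f) (subst (_< suc m) (≡-sym (length-image S f)) (m<n⇒m<1+n |S|<m))
  x = proj₁ x∉
  -- Putting `x` in the list makes `y` differ from `x`; there is room because ∣ S ∣ + 1 < m + 1.
  y∉ = missing (x ∷ image S f) (s≤s (subst (_< m) (≡-sym (length-image S f)) |S|<m))
  y = proj₁ y∉
  swapped : ∀ v → transpose x y (c v) ≡ c v
  swapped = c-unique (transpose x y ∘ c)
    (λ u v uv eq → c-proper u v uv
      (trans (≡-sym (transpose-inverse y x)) (trans (cong (transpose y x) eq) (transpose-inverse y x))))
    (λ v v∈S → trans (transpose-other x y
        (λ cv≡x → proj₂ x∉ (subst (_∈ˡ image S f) (trans (≡-sym (c-ext v v∈S)) cv≡x) (∈-image S f v∈S)))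
        (λ cv≡y → proj₂ y∉ (there (subst (_∈ˡ image S f) (trans (≡-sym (c-ext v v∈S)) cv≡y) (∈-image S f v∈S)))))
      (c-ext v v∈S))
  x-unused : ∀ v → x ≢ c v
  -- The exchange would recolour a vertex of colour `x` with `y`, so uniqueness would give `y` =
  -- `x`.
  x-unused v x≡cv = proj₂ y∉ (here (trans (≡-sym (transpose-fst x y))
    (trans (cong (transpose x y) x≡cv) (trans (swapped v) (≡-sym x≡cv)))))

-- The extremal graph

∣tabulate∣ : ∀ {n} (f : Fin n → Bool) → ∣ Vec.tabulate f ∣ ≡ sum (ind ∘ f)
∣tabulate∣ {zero}  f = refl
∣tabulate∣ {suc n} f with f zero
... | true  = cong suc (∣tabulate∣ (f ∘ suc))
... | false = ∣tabulate∣ (f ∘ suc)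

neq : ∀ {n} → Fin n → Fin n → Bool
neq i j = not (does (i ≟ j))

neq-true : ∀ {n} {i j : Fin n} → i ≢ j → neq i j ≡ true
neq-true {i = i} {j} i≢j = cong not (dec-false (i ≟ j) i≢j)

neq⇒≢ : ∀ {n} {i j : Fin n} → neq i j ≡ true → i ≢ j
neq⇒≢ {i = i} eq refl = contradiction (trans (≡-sym eq) (cong not (dec-true (i ≟ i) refl))) λ ()

neq-irrefl : ∀ {n} (i : Fin n) → neq i i ≡ false
neq-irrefl i = cong not (dec-true (i ≟ i) refl)

neq-sym : ∀ {n} (i j : Fin n) → neq i j ≡ neq j i
neq-sym i j with i ≟ j
... | yes refl = ≡-sym (neq-irrefl i)
... | no i≢j   = ≡-sym (neq-true (i≢j ∘ ≡-sym))

module Construction (m e : ℕ) (1+e<m : suc e < m) (H : Graph m) (H-regular : Regular e H) where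

  open Link m e 1+e<m

  k n : ℕ
  k = suc m
  n = k + (k + m)

  Vertex : Set
  Vertex = Fin k ⊎ (Fin k ⊎ Fin m)

  pattern A i = inj₁ i
  pattern B i = inj₂ (inj₁ i)
  pattern C i = inj₂ (inj₂ i)

  -- `C i` is the C-vertex of index i + 1, since there is no C of index 0.
  colour : Vertex → Fin k
  colour (A i) = i
  colour (B i) = i
  colour (C i) = suc i

  edge : Vertex → Vertex → Bool
  edge (A i) (A j) = neq i j
  edge (A i) (B j) = link (toℕ i) (toℕ j)
  edge (A i) (C j) = neq i (suc j)
  edge (B i) (A j) = link (toℕ j) (toℕ i)
  edge (B i) (B j) = neq i j
  edge (B i) (C j) = neq i (suc j)
  edge (C i) (A j) = neq (suc i) j
  edge (C i) (B j) = neq (suc i) j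
  edge (C i) (C j) = adj H i j

  edge-sym : ∀ x y → edge x y ≡ edge y x
  edge-sym (A i) (A j) = neq-sym i j
  edge-sym (A i) (B j) = refl
  edge-sym (A i) (C j) = neq-sym i (suc j)
  edge-sym (B i) (A j) = refl
  edge-sym (B i) (B j) = neq-sym i j
  edge-sym (B i) (C j) = neq-sym i (suc j)
  edge-sym (C i) (A j) = neq-sym (suc i) j
  edge-sym (C i) (B j) = neq-sym (suc i) j
  edge-sym (C i) (C j) = sym H i j

  edge-irrefl : ∀ x → edge x x ≡ false
  edge-irrefl (A i) = neq-irrefl i
  edge-irrefl (B i) = neq-irrefl i
  edge-irrefl (C i) = irref H i

  link⇒≢ : ∀ {i j : Fin k} → link (toℕ i) (toℕ j) ≡ true → i ≢ j
  link⇒≢ {i} eq refl = contradiction (trans (≡-sym eq) (link-irrefl (toℕ i))) λ ()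

  colour-proper : ∀ x y → edge x y ≡ true → colour x ≢ colour y
  colour-proper (A i) (A j) = neq⇒≢
  colour-proper (A i) (B j) = link⇒≢
  colour-proper (A i) (C j) = neq⇒≢
  colour-proper (B i) (A j) = λ eq → link⇒≢ eq ∘ ≡-sym
  colour-proper (B i) (B j) = neq⇒≢
  colour-proper (B i) (C j) = neq⇒≢
  colour-proper (C i) (A j) = neq⇒≢
  colour-proper (C i) (B j) = neq⇒≢
  colour-proper (C i) (C j) eq refl = contradiction (trans (≡-sym eq) (irref H i)) λ ()

  decode : Fin n → Vertex
  decode v = Sum.map₂ (splitAt k) (splitAt k v)

  encode : Vertex → Fin n
  encode x = join k (k + m) (Sum.map₂ (join k m) x)

  decode-encode : ∀ x → decode (encode x) ≡ x
  decode-encode x rewrite splitAt-join k (k + m) (Sum.map₂ (join k m) x) with x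
  ... | inj₁ i = refl
  ... | inj₂ y = cong inj₂ (splitAt-join k m y)

  encode-decode : ∀ v → encode (decode v) ≡ v
  encode-decode v = trans (cong (join k (k + m)) (cancel (splitAt k v))) (join-splitAt k (k + m) v)
    where
    cancel : ∀ x → Sum.map₂ (join k m) (Sum.map₂ (splitAt k) x) ≡ x
    cancel (inj₁ i) = refl
    cancel (inj₂ w) = cong inj₂ (join-splitAt k m w)

  G : Graph n
  G = record
    { adj   = λ u v → edge (decode u) (decode v)
    ; sym   = λ u v → edge-sym (decode u) (decode v)
    ; irref = λ v → edge-irrefl (decode v)
    }

  sum-decode : (f : Vertex → ℕ) → sum (f ∘ decode) ≡ sum (f ∘ A) + (sum (f ∘ B) + sum (f ∘ C))
  sum-decode f = begin
    sum (f ∘ decode)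
      ≡⟨ sum-splitAt k (k + m) (f ∘ decode) ⟩
    sum {k} (λ i → f (decode (i ↑ˡ (k + m)))) + sum (λ w → f (decode (k ↑ʳ w)))
      ≡⟨ cong (sum {k} (λ i → f (decode (i ↑ˡ (k + m)))) +_) (sum-splitAt k m (λ w → f (decode (k ↑ʳ w)))) ⟩
    sum (λ i → f (decode (encode (A i)))) +
      (sum (λ i → f (decode (encode (B i)))) + sum (λ i → f (decode (encode (C i)))))
      ≡⟨ cong₂ _+_ (sum-cong-≗ (λ i → cong f (decode-encode (A i))))
           (cong₂ _+_ (sum-cong-≗ (λ i → cong f (decode-encode (B i))))
                       (sum-cong-≗ (λ i → cong f (decode-encode (C i))))) ⟩
    sum (f ∘ A) + (sum (f ∘ B) + sum (f ∘ C)) ∎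
    where open ≡-Reasoning

  -- The degree outside the vertex's own clique. Index 0 has e link edges and sees all m of the C's;
  -- any other index has e + 1 link edges and misses one C. The unit removed by the switch thus
  -- makes up for the absent C of index 0.
  link+spokes : ∀ (i : Fin k) x → x + ind (toℕ i ≡ᵇ 0) ≡ suc e → x + sum (λ j → ind (neq i (suc j))) ≡ m + e
  link+spokes zero x eq = trans (cong₂ _+_ (suc-injective (trans (+-comm 1 x) eq)) (sum-≢ {m} zero)) (+-comm e m)
  link+spokes (suc i) x eq = trans (cong (_+ y) (trans (≡-sym (+-identityʳ x)) eq))
    (trans (≡-sym (+-suc e y)) (trans (cong (e +_) (sum-≢ (suc i))) (+-comm e m)))
    where y = sum (λ j → ind (neq {k} (suc i) (suc j)))

  edge-degree : ∀ x →
    sum (λ j → ind (edge x (A j))) + (sum (λ j → ind (edge x (B j))) + sum (λ j → ind (edge x (C j))))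
      ≡ m + (m + e)
  edge-degree (A i) = cong₂ _+_ (sum-≢ i) (link+spokes i _ (link-row (toℕ i) (s≤s⁻¹ (toℕ<n i))))
  -- For a B-vertex the links are column entries and its own clique is the second summand, hence the
  -- rearrangement.
  edge-degree (B i) = trans (x+[y+z]≡y+[x+z] (sum {k} λ j → ind (link (toℕ j) (toℕ i))) (sum {k} (ind ∘ neq i)) _)
    (cong₂ _+_ (sum-≢ i) (link+spokes i _ (link-col (toℕ i) (s≤s⁻¹ (toℕ<n i)))))
    where
    x+[y+z]≡y+[x+z] : ∀ x y z → x + (y + z) ≡ y + (x + z)
    x+[y+z]≡y+[x+z] = solve-∀
  edge-degree (C i) = cong₂ _+_ (sum-≢ (suc i))
    (cong₂ _+_ (sum-≢ (suc i)) (trans (≡-sym (degree-sum H i)) (H-regular i)))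

  G-regular : Regular (m + (m + e)) G
  G-regular v = trans (degree-sum G v) (trans (sum-decode (ind ∘ edge (decode v))) (edge-degree (decode v)))

  adj-encode : ∀ {x y} → edge x y ≡ true → adj G (encode x) (encode y) ≡ true
  adj-encode {x} {y} eq = trans (cong₂ edge (decode-encode x) (decode-encode y)) eq

  G-chromatic : ChromaticNumber G k
  G-chromatic = (colour ∘ decode , λ u v → colour-proper (decode u) (decode v)) , λ l l<k (c , c-proper) →
    -- The A's form a clique on k vertices, so fewer than k colours must repeat on it.
    let i , j , i<j , eq = pigeonhole l<k (c ∘ encode ∘ A)
    in c-proper _ _ (adj-encode {A i} {A j} (neq-true (<⇒≢ i<j ∘ cong toℕ))) eq

  isC : Vertex → Bool
  isC (A _) = false
  isC (B _) = false
  isC (C _) = true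

  Cs : Subset n
  Cs = Vec.tabulate (isC ∘ decode)

  ∣Cs∣ : ∣ Cs ∣ ≡ m
  ∣Cs∣ = trans (∣tabulate∣ (isC ∘ decode)) (trans (sum-decode (ind ∘ isC))
    (cong₂ _+_ (sum-zero k) (cong₂ _+_ (sum-zero k) (sum-one m))))

  C∈Cs : ∀ j → encode (C j) ∈ Cs
  C∈Cs j = lookup⇒[]= (encode (C j)) Cs
    (trans (lookup∘tabulate (isC ∘ decode) (encode (C j))) (cong isC (decode-encode (C j))))

  -- In either clique, vertex 0 sees every C, so it is forced to colour 0, and this forces the others.
  forced : (c : Vertex → Fin k) → (∀ x y → edge x y ≡ true → c x ≢ c y) → (∀ j → c (C j) ≡ suc j) →
    (X : Fin k → Vertex) → (∀ i j → edge (X i) (X j) ≡ neq i j) → (∀ i j → edge (X i) (C j) ≡ neq i (suc j)) →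
    ∀ i → c (X i) ≡ i
  forced c c-proper cC X XX XC = λ { zero → zero-forced ; (suc i) → suc-forced i }
    where
    avoids-C : ∀ i {j} → i ≢ suc j → c (X i) ≢ suc j
    avoids-C i {j} i≢ eq = c-proper (X i) (C j) (trans (XC i j) (neq-true i≢)) (trans eq (≡-sym (cC j)))
    zero-forced : c (X zero) ≡ zero
    zero-forced with c (X zero) in eq
    ... | zero  = refl
    ... | suc j = contradiction eq (avoids-C zero λ ())
    suc-forced : ∀ i → c (X (suc i)) ≡ suc i
    suc-forced i with c (X (suc i)) in eq
    ... | zero  = contradiction (trans eq (≡-sym zero-forced)) (c-proper _ _ (trans (XX (suc i) zero) refl))
    ... | suc j with i ≟ j
    ...   | yes refl = refl
    ...   | no i≢j   = contradiction eq (avoids-C (suc i) λ { refl → i≢j refl })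

  Cs-defining : IsDefiningSet G k Cs (colour ∘ decode)
  Cs-defining = colour ∘ decode , (λ u v → colour-proper (decode u) (decode v)) , (λ _ _ → refl) ,
    λ c c-proper c-ext v → trans (cong c (≡-sym (encode-decode v))) (unique c c-proper c-ext (decode v))
    where
    unique : ∀ c → Proper G c → Extends Cs (colour ∘ decode) c → ∀ x → c (encode x) ≡ colour x
    unique c c-proper c-ext = λ
      { (A i) → forced c′ c′-proper c′C (λ j → A j) (λ _ _ → refl) (λ _ _ → refl) i
      ; (B i) → forced c′ c′-proper c′C (λ j → B j) (λ _ _ → refl) (λ _ _ → refl) i
      ; (C i) → c′C i }
      where
      c′ = c ∘ encode
      c′-proper : ∀ x y → edge x y ≡ true → c′ x ≢ c′ y
      c′-proper x y eq = c-proper (encode x) (encode y) (adj-encode {x} {y} eq)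
      c′C : ∀ j → c′ (C j) ≡ suc j
      c′C j = trans (c-ext (encode (C j)) (C∈Cs j)) (cong colour (decode-encode (C j)))

  G-definingNumber : DefiningNumber G k m
  G-definingNumber = (Cs , colour ∘ decode , ∣Cs∣ , Cs-defining) , ∣definingSet∣≥χ-1 G G-chromatic

-- Restrictions on the degree

-- The handshake lemma by induction: symmetry makes the first row and the first column contribute
-- equally, and the diagonal is zero.
2∣sum-symmetric : ∀ n (f : Fin n → Fin n → ℕ) → (∀ u v → f u v ≡ f v u) → (∀ v → f v v ≡ 0) →
  2 ∣ sum (λ u → sum (f u))
2∣sum-symmetric zero    f f-sym f-diag = divides 0 refl
2∣sum-symmetric (suc n) f f-sym f-diag = subst (2 ∣_) (≡-sym eq)
  (∣m∣n⇒∣m+n (2∣p+p R) (2∣sum-symmetric n (λ u v → f (suc u) (suc v)) (λ u v → f-sym (suc u) (suc v)) (f-diag ∘ suc)))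
  where
  open ≡-Reasoning
  R Q : ℕ
  R = sum (λ v → f zero (suc v))
  Q = sum (λ u → sum (λ v → f (suc u) (suc v)))
  eq : sum (λ u → sum (f u)) ≡ R + R + Q
  eq = begin
    f zero zero + R + sum (λ u → f (suc u) zero + sum (λ v → f (suc u) (suc v)))
      ≡⟨ cong₂ (λ x y → x + R + y) (f-diag zero) (∑-distrib-+ (λ u → f (suc u) zero) _) ⟩
    R + (sum (λ u → f (suc u) zero) + Q)
      ≡⟨ cong (λ x → R + (x + Q)) (sum-cong-≗ (λ u → f-sym (suc u) zero)) ⟩
    R + (R + Q)
      ≡⟨ +-assoc R R Q ⟨
    R + R + Q ∎

regular⇒2∣n*r : ∀ {n r} (G : Graph n) → Regular r G → 2 ∣ n * r
regular⇒2∣n*r {n} {r} G G-regular = subst (2 ∣_)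
  (trans (sum-cong-≗ (λ u → trans (≡-sym (degree-sum G u)) (G-regular u))) (sum-const n r))
  (2∣sum-symmetric n (λ u v → ind (adj G u v)) (λ u v → cong ind (sym G u v)) (λ v → cong ind (irref G v)))

module DegreeBound {n r k : ℕ} (1<k : 1 < k) (1+n≡3k : suc n ≡ k * 3)
  (G : Graph n) (G-regular : Regular r G) (c : Fin n → Fin k) (c-proper : Proper G c) where

  -- A vertex counts as its own non-neighbour, so every vertex has exactly n - r of them, and they
  -- include its whole colour class.
  nonadj : Fin n → Fin n → Bool
  nonadj u v = not (adj G u v)

  nonadj-sym : ∀ u v → nonadj u v ≡ nonadj v u
  nonadj-sym u v = cong not (sym G u v)

  sum-nonadj : ∀ u → sum (ind ∘ nonadj u) + r ≡ n
  sum-nonadj u = trans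
    (cong (sum (ind ∘ nonadj u) +_) (≡-sym (trans (≡-sym (degree-sum G u)) (G-regular u))))
    (sum-not (adj G u))

  classSize : Fin k → ℕ
  classSize j = sum (λ v → ind (does (c v ≟ j)))

  sum-classSize : sum classSize ≡ n
  sum-classSize = trans (∑-comm (λ j v → ind (does (c v ≟ j))))
    (trans (sum-cong-≗ (λ v → sum-≟ (c v))) (sum-one n))

  class-occupied : ∀ {j} → 0 < classSize j → ∃ λ v → c v ≡ j
  class-occupied {j} 0<s with sum-<⇒∃< {f = λ _ → 0} (subst (_< classSize j) (≡-sym (sum-zero n)) 0<s)
  ... | v , 0<ind with c v ≟ j
  ...   | yes cv≡j = v , cv≡j

  class≤nonadj : ∀ u v → ind (does (c v ≟ c u)) ≤ ind (nonadj u v)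
  class≤nonadj u v with c v ≟ c u | adj G u v in eq
  ... | no  _    | _     = z≤n
  ... | yes _    | false = ≤-refl
  ... | yes cv≡cu | true = contradiction (≡-sym cv≡cu) (c-proper u v eq)

  classSize≤sum-nonadj : ∀ u → classSize (c u) ≤ sum (ind ∘ nonadj u)
  classSize≤sum-nonadj u = sum-mono (class≤nonadj u)

  -- Compare the two counts vertex by vertex: some `w` counts only for the larger one.
  outside-nonneighbour : ∀ v → classSize (c v) < sum (ind ∘ nonadj v) → ∃ λ w → c w ≢ c v × nonadj v w ≡ true
  outside-nonneighbour v s<q
    with sum-<⇒∃< {f = λ w → ind (does (c w ≟ c v))} {ind ∘ nonadj v} s<q
  ... | w , same<nonadj = w , decide (c w ≟ c v) (nonadj v w) same<nonadj
    where
    decide : ∀ {P : Set} (p? : Dec P) b → ind (does p?) < ind b → ¬ P × b ≡ true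
    decide (no ¬p) true  _        = ¬p , refl
    decide (yes _) true  (s≤s ())

  -- The class of `w` lies among the non-neighbours of `w`, and `v` is a non-neighbour outside it,
  -- so the inclusion is strict.
  classSize<sum-nonadj : ∀ v w → c w ≢ c v → nonadj v w ≡ true → classSize (c w) < sum (ind ∘ nonadj w)
  classSize<sum-nonadj v w cw≢cv v≁w = sum-mono-< (class≤nonadj w) v
    (subst₂ _<_ (cong ind (≡-sym (dec-false (c v ≟ c w) (cw≢cv ∘ ≡-sym))))
      (cong ind (≡-sym (trans (nonadj-sym w v) v≁w))) (s≤s z≤n))

  -- The deficits 3 − classSize would sum to 1, so at most one class can be smaller than 3.
  module _ (n<r+4 : n < r + 4) where

    sum-nonadj≤3 : ∀ u → sum (ind ∘ nonadj u) ≤ 3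
    sum-nonadj≤3 u = s≤s⁻¹ (+-cancelʳ-< r _ 4 (subst₂ _<_ (≡-sym (sum-nonadj u)) (+-comm r 4) n<r+4))

    classSize≤3 : ∀ j → classSize j ≤ 3
    -- An empty class has no member whose non-neighbours could bound it, so it is treated apart.
    classSize≤3 j with 0 <? classSize j
    ... | no ¬0<s = ≤-trans (≮⇒≥ ¬0<s) z≤n
    ... | yes 0<s with class-occupied 0<s
    ...   | v , refl = ≤-trans (classSize≤sum-nonadj v) (sum-nonadj≤3 v)

    deficit : Fin k → ℕ
    deficit j = 3 ∸ classSize j

    sum-deficit : sum deficit ≡ 1
    sum-deficit = +-cancelˡ-≡ n _ 1 (begin
      n + sum deficit                          ≡⟨ cong (_+ sum deficit) sum-classSize ⟨
      sum classSize + sum deficit              ≡⟨ ∑-distrib-+ classSize deficit ⟨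
      sum (λ j → classSize j + deficit j)      ≡⟨ sum-cong-≗ (λ j → m+[n∸m]≡n (classSize≤3 j)) ⟩
      sum {k} (λ _ → 3)                        ≡⟨ sum-const k 3 ⟩
      k * 3                                    ≡⟨ 1+n≡3k ⟨
      suc n                                    ≡⟨ +-comm 1 n ⟩
      n + 1                                    ∎)
      where open ≡-Reasoning

    -- Two positive deficits would add up to at least 2, but the total is 1.
    deficit-unique : ∀ {i j} → i ≢ j → classSize i < 3 → ¬ classSize j < 3
    deficit-unique i≢j si<3 sj<3 = <-irrefl refl (≤-trans (+-mono-≤ (m<n⇒0<n∸m si<3) (m<n⇒0<n∸m sj<3))
      (≤-trans (+-≤-sum deficit i≢j) (≤-reflexive sum-deficit)))

    small : ∃ λ v → classSize (c v) < 3
    small with sum-<⇒∃< {f = λ _ → 0} {deficit} (subst₂ _<_ (≡-sym (sum-zero k)) (≡-sym sum-deficit) (s≤s z≤n))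
    -- The class found has a member: an empty class would have deficit 3, exceeding the total 1.
    ... | j , 0<d with class-occupied (n≢0⇒n>0 λ s≡0 →
          contradiction (subst₂ (λ s d → 3 ∸ s ≤ d) s≡0 sum-deficit (≤-sum deficit j)) (from-no (3 ≤? 1)))
    ...   | v , refl = v , 0<n∸m⇒m<n 0<d
      where
      0<n∸m⇒m<n : ∀ {m n} → 0 < n ∸ m → m < n
      0<n∸m⇒m<n {m} {n} 0<n∸m = ≰⇒> λ n≤m → <⇒≢ 0<n∸m (≡-sym (m≤n⇒m∸n≡0 n≤m))

    another-small : ∀ v → classSize (c v) < 3 → ∃ λ j → j ≢ c v × classSize j < 3
    another-small v v-small with sum (ind ∘ nonadj v) <? 3
    -- Here n - r = 3 exceeds the class of `v`, so `v` has a non-neighbour `w` of another colour,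
    -- and the class of `w` falls short of 3 too.
    ... | no q≮3 =
          let w , cw≢cv , v≁w = outside-nonneighbour v (<-≤-trans v-small (≮⇒≥ q≮3))
          in c w , cw≢cv , <-≤-trans (classSize<sum-nonadj v w cw≢cv v≁w) (sum-nonadj≤3 w)
    -- Here n - r < 3 bounds every class, and a second colour exists because k > 1.
    ... | yes q<3 = proj₁ (other 1<k (c v)) , proj₂ (other 1<k (c v)) , all-small _
      where
      other : ∀ {k} → 1 < k → (i : Fin k) → ∃ λ j → j ≢ i
      other (s≤s (s≤s _)) i = punchIn i zero , punchInᵢ≢i i zero
      all-small : ∀ j → classSize j < 3
      all-small j with 0 <? classSize j
      ... | no ¬0<s = ≤-<-trans (≮⇒≥ ¬0<s) (s≤s z≤n)
      ... | yes 0<s with class-occupied 0<s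
      ...   | w , refl = ≤-<-trans (classSize≤sum-nonadj w)
              (subst (_< 3) (+-cancelʳ-≡ r _ _ (trans (sum-nonadj v) (≡-sym (sum-nonadj w)))) q<3)

  r+4≤n : r + 4 ≤ n
  r+4≤n = ≮⇒≥ λ n<r+4 → 
    let v , v-small = small n<r+4
        j , j≢ , j-small = another-small n<r+4 v v-small
    in deficit-unique n<r+4 j≢ j-small v-small

-- Assembly of the bounds and the construction

minDefiningNumber : ∀ m e → 1 < m →
  Σ (Graph (suc m + (suc m + m))) (λ G → Regular (m + (m + e)) G × ChromaticNumber G (suc m)) →
  MinDefiningNumber (suc m + (suc m + m)) (m + (m + e)) (suc m) m
minDefiningNumber m e 1<m (G₀ , G₀-regular , (c , c-proper) , _) =
  (G , G-regular , G-chromatic , G-definingNumber) ,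
  λ { G' _ χ m' ((S , f , refl , S-defining) , _) → ∣definingSet∣≥χ-1 G' χ S f S-defining }
  where
  size : ∀ m → suc (suc m + (suc m + m)) ≡ suc m * 3
  size = solve-∀
  1+e<m : suc e < m
  -- From r + 4 ≤ n with r = 2m + e and n = 3m + 2; cancelling 2m + 2 leaves e + 2 ≤ m.
  1+e<m = +-cancelˡ-≤ (m + m + 2) _ _ (subst₂ _≤_ (lhs m e) (rhs m)
    (DegreeBound.r+4≤n (m<n⇒m<1+n 1<m) (size m) G₀ G₀-regular c c-proper))
    where
    lhs : ∀ m e → m + (m + e) + 4 ≡ m + m + 2 + suc (suc e)
    lhs = solve-∀
    rhs : ∀ m → suc m + (suc m + m) ≡ m + m + 2 + m
    rhs = solve-∀
  even : (2 ∣ m) ⊎ (2 ∣ e)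
  -- The product n r is even, n has the parity of m, and r has the parity of e.
  even = Sum.map
    (λ d → ∣m+n∣m⇒∣n (subst (2 ∣_) (order m) d) (2∣p+p (suc m)))
    (λ d → ∣m+n∣m⇒∣n (subst (2 ∣_) (≡-sym (+-assoc m m e)) d) (2∣p+p m))
    (euclidsLemma (suc m + (suc m + m)) (m + (m + e)) (from-yes (prime? 2)) (regular⇒2∣n*r G₀ G₀-regular))
    where
    order : ∀ m → suc m + (suc m + m) ≡ suc m + suc m + m
    order = solve-∀
  H = regular-graph m e (<-trans (n<1+n e) 1+e<m) even
  open Construction m e 1+e<m (proj₁ H) (proj₂ H)

theorem3p1 : (k r : ℕ) → 3 ≤ k → 2 * (k ∸ 1) ≤ r →
    Σ (Graph (3 * k ∸ 1)) (λ G → Regular r G × ChromaticNumber G k) →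
    MinDefiningNumber (3 * k ∸ 1) r k (k ∸ 1)
theorem3p1 (suc m) r (s≤s 1<m) 2m≤r with m≤n⇒∃[o]m+o≡n 2m≤r
... | e , refl = subst₂
  (λ n r → Σ (Graph n) (λ G → Regular r G × ChromaticNumber G (suc m)) → MinDefiningNumber n r (suc m) m)
  (order m) (degree-eq m e) (minDefiningNumber m e 1<m)
  where
  -- The right-hand side is what `3 * suc m ∸ 1` computes to.
  order : ∀ m → suc m + (suc m + m) ≡ m + (suc m + (suc m + 0))
  order = solve-∀
  degree-eq : ∀ m e → m + (m + e) ≡ 2 * m + e
  degree-eq = solve-∀
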